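{- Let $G=(V,E)$ be the graph with $$V=\{a,b,x,c,d\},\qquad E=\{ab,bc,bd,xc,xd\},$$ let the target be $x$, and take initial weights $\omega=(2,5,1,0,0)$ in the order $(a,b,x,c,d)$. The maximum of $(A_\sigma\omega)_x$ over all strategies $\sigma$ is $65/32$, whereas the maximum of $(A_\sigma\omega)_x$ over all repetition-free strategies $\sigma$ is $2$. Thus every optimal strategy (one attaining $65/32$) averages some nontrivial connected set at least twice. The minimum length of an optimal strategy is $4$.
   Context: A nonempty set $S\subseteq V$ is called connected if the induced subgraph $G[S]$ is connected; it is nontrivial if $|S|\ge2$. For nonempty connected $S$, the averaging operator $A_S\in\mathbb R^{V\times V}$ is defined by $(A_Sz)_v=|S|^{ -1}\sum_{u\in S}z_u$ if $v\in S$ and $(A_Sz)_v=z_v$ if $v\notin S$. A strategy is a finite (possibly empty) sequence $\sigma=(S_1,\ldots,S_k)$ of nonempty connected sets, listed in chronological order; its length is $k$ and its operator is $A_\sigma=A_{S_k}\cdots A_{S_1}$ (the identity if $k=0$). A strategy is repetition-free if no nontrivial connected set occurs in it more than once. -}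

module Defs where

open import Data.Bool.Properties as Bool using ()
open import Data.Fin using (Fin; zero; suc)
open import Data.Fin.Subset using (Subset; inside; outside; _∈_; Nonempty; ∣_∣)
open import Data.Fin.Subset.Properties using (_∈?_)
open import Data.Integer using (+_)
open import Data.List using (List; []; _∷_; length; filter; map)
open import Data.Nat as ℕ using (ℕ; NonZero)
open import Data.Product using (∃; ∃-syntax; _×_; _,_; proj₁; proj₂)
open import Data.Rational as ℚ using (ℚ; 0ℚ; _/_; _*_)
open import Data.Rational.Properties using (+-0-commutativeMonoid)
open import Data.Vec using (_∷_; there)
open import Data.Vec.Properties using (≡-dec)
open import Function using (_∘_; id)
open import Relation.Binary using (Rel; Symmetric; Irreflexive)
open import Relation.Binary.Construct.Closure.ReflexiveTransitive using (Star)
open import Relation.Binary.Construct.Closure.Symmetric using (SymClosure; fwd; bwd; symmetric)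
open import Relation.Binary.PropositionalEquality using (_≡_; refl)
open import Relation.Nullary using (yes; no)
open import Relation.Unary using (Pred)
open import Algebra.Properties.CommutativeMonoid.Sum +-0-commutativeMonoid using (sum)
open import Level using (0ℓ)

record Graph (V : Set) : Set₁ where
  field
    Adj        : Rel V 0ℓ
    Adj-sym    : Symmetric Adj
    Adj-irrefl : Irreflexive _≡_ Adj

induced : ∀ {V} → Graph V → (P : Pred V 0ℓ) → Graph (∃ P)
induced G P = record
  { Adj        = λ u v → Adj (proj₁ u) (proj₁ v)
  ; Adj-sym    = Adj-sym
  ; Adj-irrefl = λ { refl → Adj-irrefl refl }
  }
  where open Graph G

-- The empty graph counts as connected here; nonemptiness is always required
-- separately below.
IsConnected : ∀ {V} → Graph V → Set
IsConnected {V} G = (u v : V) → Star (Graph.Adj G) u v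

Nontrivial : ∀ {n} → Subset n → Set
Nontrivial S = 2 ℕ.≤ ∣ S ∣

nonempty⇒nonZero : ∀ {n} {S : Subset n} → Nonempty S → NonZero ∣ S ∣
nonempty⇒nonZero {S = inside  ∷ S} _                   = _
nonempty⇒nonZero {S = outside ∷ S} (suc v , there v∈S) = nonempty⇒nonZero (v , v∈S)

record ConnectedSet {n} (G : Graph (Fin n)) : Set where
  constructor connectedSet
  field
    set       : Subset n
    nonempty  : Nonempty set
    connected : IsConnected (induced G (_∈ set))

open ConnectedSet

-- Rational rather than real weights: averaging never leaves the rationals.
Weights : ℕ → Set
Weights n = Fin n → ℚ

restrict : ∀ {n} → Subset n → Weights n → Weights n
restrict S z u with u ∈? S
... | yes _ = z u
... | no  _ = 0ℚ

average : ∀ {n} {G : Graph (Fin n)} → ConnectedSet G → Weights n → Weights n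
average S z v with v ∈? set S
... | yes _ = (+ 1 / ∣ set S ∣) {{nonempty⇒nonZero (nonempty S)}} * sum (restrict (set S) z)
... | no  _ = z v

-- Sets are listed in chronological order, the first one applied at the head.
Strategy : ∀ {n} → Graph (Fin n) → Set
Strategy G = List (ConnectedSet G)

operator : ∀ {n} {G : Graph (Fin n)} → Strategy G → Weights n → Weights n
operator []      = id
operator (S ∷ σ) = operator σ ∘ average S

-- Occurrences are compared as subsets, ignoring the attached proofs.
occurrences : ∀ {n} {G : Graph (Fin n)} → Subset n → Strategy G → ℕ
occurrences S σ = length (filter (≡-dec Bool._≟_ S) (map set σ))

RepetitionFree : ∀ {n} {G : Graph (Fin n)} → Strategy G → Set
RepetitionFree {G = G} σ =
  (S : ConnectedSet G) → Nontrivial (set S) → occurrences (set S) σ ℕ.≤ 1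

IsMaximum : {A : Set} → Pred A 0ℓ → (A → ℚ) → ℚ → Set
IsMaximum P f m = (∃[ a ] P a × f a ≡ m) × (∀ a → P a → f a ℚ.≤ m)

IsMinimum : {A : Set} → Pred A 0ℓ → (A → ℕ) → ℕ → Set
IsMinimum P f m = (∃[ a ] P a × f a ≡ m) × (∀ a → P a → m ℕ.≤ f a)

module Example where

  V : Set
  V = Fin 5

  pattern a = zero
  pattern b = suc zero
  pattern x = suc (suc zero)
  pattern c = suc (suc (suc zero))
  pattern d = suc (suc (suc (suc zero)))

  data Edge : Rel V 0ℓ where
    ab : Edge a b
    bc : Edge b c
    bd : Edge b d
    xc : Edge x c
    xd : Edge x d

  G : Graph V
  G = record
    { Adj        = SymClosure Edge
    ; Adj-sym    = symmetric Edge
    ; Adj-irrefl = λ { refl (fwd ()) ; refl (bwd ()) }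
    }

  ω : Weights 5
  ω a = + 2 / 1
  ω b = + 5 / 1
  ω x = + 1 / 1
  ω c = 0ℚ
  ω d = 0ℚ

  final : Strategy G → ℚ
  final σ = operator σ ω x

  Optimal : Strategy G → Set
  Optimal σ = final σ ≡ + 65 / 32

{-# OPTIONS --safe #-}
module Submission where

-- The effect of a strategy on the weight of the target is a linear functional
-- of the weights, and averaging is self-adjoint. A finite family of functionals
-- that contains the evaluation at x, and whose averages over the admissible
-- sets are all dominated coefficientwise by convex combinations of the family,
-- therefore bounds the target after any admissible strategy by its largest
-- value at the current weights, which are nonnegative (below-operator). That a
-- given family has this property is a finite computation with natural numbers.
-- Functionals that take the constant value 2 on the reachable weights may be
-- included, which keeps the families small.
--
-- For the example, a family of 19 functionals is preserved by averaging over all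
-- connected sets and has largest value 65/32 at the initial weights. It is built
-- up in layers such that k averagings only need the k-th layer, and the layers
-- up to the third have largest value 2 (family-preserved, ω-below,
-- ω-below-short). Hence no strategy exceeds 65/32, and none with fewer than four
-- steps exceeds 2. The strategy {x,d}, {b,d}, {a,b,x,c}, {x,d} attains 65/32.
--
-- For repetition-free strategies, the same family has largest value 2 as soon
-- as the first nontrivial set differs from {x,c} and {x,d} (ω-after-other). If
-- the first nontrivial set is {x,c}, it cannot occur again, and a second family,
-- preserved by averaging over all the other connected sets, has largest value 2
-- after that step (family-xc-preserved, ω-after-xc); the case {x,d} is
-- symmetric. So repetition-free strategies stay below or at 2, which {b,x,c}
-- attains, and an optimal strategy must repeat a nontrivial set.

open import Defs
open import Data.Bool using (if_then_else_)
open import Data.Bool.Properties as Bool using ()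
open import Data.Fin using (Fin; zero; suc)
open import Data.Fin.Subset using (Subset; inside; outside; _∈_; _∉_; ⊥; ⁅_⁆; _∪_; ∣_∣; Empty)
open import Data.Fin.Subset.Properties using (_∈?_; nonempty?; anySubset?; ∣⁅x⁆∣≡1)
open import Data.Integer as ℤ using (+_)
open import Data.Integer.Properties as ℤ using ()
open import Data.List using (List; []; _∷_; _++_; length; map; filter; allFin)
open import Data.List.Membership.Propositional as List using (find; lose)
open import Data.List.Membership.Propositional.Properties using (∈-++⁻; ∈-filter⁺; ∈-map⁻)
import Data.List.Membership.DecPropositional as DecMembership
open import Data.List.Properties using (length-filter; filter-none)
open import Data.List.Relation.Unary.All as All using (All; []; _∷_)
open import Data.List.Relation.Unary.All.Properties as All using ()
open import Data.List.Relation.Unary.Any as Any using (Any; here; there)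
open import Data.Nat as ℕ using (ℕ; zero; suc; _≤_; NonZero; z≤n; s≤s)
open import Data.Nat.Properties as ℕ using ()
open import Data.Product using (_×_; _,_; proj₁; proj₂; ∃; ∃-syntax)
open import Data.Rational as ℚ using (ℚ; 0ℚ; 1ℚ; _/_; _+_; _*_)
open import Data.Rational.Properties as ℚ using ()
open import Data.Rational.Unnormalised as ℚᵘ using (mkℚᵘ; *≡*; *≤*)
open import Data.Rational.Unnormalised.Properties as ℚᵘ using ()
open import Data.Sum using (_⊎_; inj₁; inj₂)
open import Data.Vec as Vec using (Vec; []; _∷_; lookup; zipWith; here; there)
open import Data.Vec.Properties using (≡-dec; lookup-zipWith; lookup-map; []=⇒lookup; lookup⇒[]=)
open import Data.Vec.Relation.Binary.Pointwise.Inductive as Pointwise using (Pointwise)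
open import Function using (_∘_; const)
open import Relation.Binary.PropositionalEquality
open import Relation.Nullary using (Dec; yes; no; ¬_; ¬?; contradiction; _×-dec_; _⊎-dec_; _→-dec_)
open import Relation.Nullary.Decidable using (from-yes; from-no; decidable-stable)
open import Relation.Unary using (U)
open import Algebra.Properties.CommutativeMonoid.Sum ℚ.+-0-commutativeMonoid using (sum; sum-cong-≗; ∑-distrib-+)
open import Algebra.Bundles using (module CommutativeRing)
open import Algebra.Properties.Semiring.Sum (CommutativeRing.semiring ℚ.+-*-commutativeRing) using (*-distribˡ-sum; *-distribʳ-sum)
open import Data.Rational.Solver using (module +-*-Solver)
open import Data.Fin.Properties as Fin using ()
open import Relation.Binary.Construct.Closure.ReflexiveTransitive using (Star; ε; _◅_; _◅◅_; reverse)
open import Relation.Binary.Construct.Closure.Symmetric using (fwd; bwd)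

open ConnectedSet

-- Natural numbers as rationals

-- The embedding of the natural numbers into the rationals.
ι : ℕ → ℚ
ι k = + k / 1

toℚᵘ-ι : ∀ k → ℚ.toℚᵘ (ι k) ℚᵘ.≃ mkℚᵘ (+ k) 0
toℚᵘ-ι k = ℚ.toℚᵘ-fromℚᵘ (mkℚᵘ (+ k) 0)

ι-+ : ∀ k l → ι (k ℕ.+ l) ≡ ι k + ι l
ι-+ k l = ℚ.toℚᵘ-injective (begin
  ℚ.toℚᵘ (ι (k ℕ.+ l))             ≈⟨ toℚᵘ-ι (k ℕ.+ l) ⟩
  mkℚᵘ (+ (k ℕ.+ l)) 0             ≈⟨ *≡* (cong (ℤ._* + 1) (sym (cong₂ ℤ._+_ (ℤ.*-identityʳ (+ k)) (ℤ.*-identityʳ (+ l))))) ⟩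
  mkℚᵘ (+ k) 0 ℚᵘ.+ mkℚᵘ (+ l) 0   ≈⟨ ℚᵘ.+-cong (toℚᵘ-ι k) (toℚᵘ-ι l) ⟨
  ℚ.toℚᵘ (ι k) ℚᵘ.+ ℚ.toℚᵘ (ι l)   ≈⟨ ℚ.toℚᵘ-homo-+ (ι k) (ι l) ⟨
  ℚ.toℚᵘ (ι k + ι l)               ∎)
  where open ℚᵘ.≃-Reasoning

ι-* : ∀ k l → ι (k ℕ.* l) ≡ ι k * ι l
ι-* k l = ℚ.toℚᵘ-injective (begin
  ℚ.toℚᵘ (ι (k ℕ.* l))             ≈⟨ toℚᵘ-ι (k ℕ.* l) ⟩
  mkℚᵘ (+ (k ℕ.* l)) 0             ≈⟨ *≡* (cong (ℤ._* + 1) (ℤ.pos-* k l)) ⟩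
  mkℚᵘ (+ k) 0 ℚᵘ.* mkℚᵘ (+ l) 0   ≈⟨ ℚᵘ.*-cong (toℚᵘ-ι k) (toℚᵘ-ι l) ⟨
  ℚ.toℚᵘ (ι k) ℚᵘ.* ℚ.toℚᵘ (ι l)   ≈⟨ ℚ.toℚᵘ-homo-* (ι k) (ι l) ⟨
  ℚ.toℚᵘ (ι k * ι l)               ∎)
  where open ℚᵘ.≃-Reasoning

ι-mono-≤ : ∀ {k l} → k ≤ l → ι k ℚ.≤ ι l
ι-mono-≤ {k} {l} k≤l = ℚ.toℚᵘ-cancel-≤ (begin
  ℚ.toℚᵘ (ι k)   ≃⟨ toℚᵘ-ι k ⟩
  mkℚᵘ (+ k) 0   ≤⟨ *≤* (ℤ.*-monoʳ-≤-nonNeg (+ 1) (ℤ.+≤+ k≤l)) ⟩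
  mkℚᵘ (+ l) 0   ≃⟨ toℚᵘ-ι l ⟨
  ℚ.toℚᵘ (ι l)   ∎)
  where open ℚᵘ.≤-Reasoning

ι-nonNeg : ∀ k → ℚ.NonNegative (ι k)
ι-nonNeg k = ℚ.nonNegative (ι-mono-≤ {0} {k} z≤n)

ι-pos : ∀ k .{{_ : NonZero k}} → ℚ.Positive (ι k)
ι-pos (suc k) = ℚ.normalize-pos (suc k) 1

ι-*-1/ : ∀ k .{{_ : NonZero k}} → ι k * (+ 1 / k) ≡ 1ℚ
ι-*-1/ k@(suc k-1) = ℚ.toℚᵘ-injective (begin
  ℚ.toℚᵘ (ι k * (+ 1 / k))                ≈⟨ ℚ.toℚᵘ-homo-* (ι k) (+ 1 / k) ⟩
  ℚ.toℚᵘ (ι k) ℚᵘ.* ℚ.toℚᵘ (+ 1 / k)      ≈⟨ ℚᵘ.*-cong (toℚᵘ-ι k) (ℚ.toℚᵘ-fromℚᵘ (mkℚᵘ (+ 1) k-1)) ⟩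
  mkℚᵘ (+ k) 0 ℚᵘ.* mkℚᵘ (+ 1) k-1        ≈⟨ *≡* (trans (ℤ.*-identityʳ _) (trans (ℤ.*-identityʳ (+ k)) (sym (trans (ℤ.*-identityˡ _) (ℤ.*-identityˡ (+ k)))))) ⟩
  ℚ.toℚᵘ 1ℚ                               ∎)
  where open ℚᵘ.≃-Reasoning

-- Nonnegativity and monotonicity of finite sums

*-nonNeg : ∀ {p q} → 0ℚ ℚ.≤ p → 0ℚ ℚ.≤ q → 0ℚ ℚ.≤ p * q
*-nonNeg {p} {q} 0≤p 0≤q =
  ℚ.nonNegative⁻¹ (p * q) {{ℚ.nonNeg*nonNeg⇒nonNeg p {{ℚ.nonNegative 0≤p}} q {{ℚ.nonNegative 0≤q}}}}

sum-mono-≤ : ∀ {n} {f g : Fin n → ℚ} → (∀ v → f v ℚ.≤ g v) → sum f ℚ.≤ sum g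
sum-mono-≤ {zero}  f≤g = ℚ.≤-refl
sum-mono-≤ {suc n} f≤g = ℚ.+-mono-≤ (f≤g zero) (sum-mono-≤ (f≤g ∘ suc))

sum-nonNeg : ∀ {n} {f : Fin n → ℚ} → (∀ v → 0ℚ ℚ.≤ f v) → 0ℚ ℚ.≤ sum f
sum-nonNeg {zero}  0≤f = ℚ.≤-refl
sum-nonNeg {suc n} 0≤f = ℚ.+-mono-≤ (0≤f zero) (sum-nonNeg (0≤f ∘ suc))

-- Linear functionals and the adjoint of averaging

-- A linear functional on weights with natural coefficients. A common
-- denominator is chosen once, for the concrete families below.
Functional : ℕ → Set
Functional = Vec ℕ

infixl 7 _·_
_·_ : ∀ {n} → Functional n → Weights n → ℚ
p · z = sum (λ v → ι (lookup p v) * z v)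

NonNeg : ∀ {n} → Weights n → Set
NonNeg z = ∀ v → 0ℚ ℚ.≤ z v

restrict-nonNeg : ∀ {n} (T : Subset n) {z : Weights n} → NonNeg z → NonNeg (restrict T z)
restrict-nonNeg T 0≤z v with v ∈? T
... | yes _ = 0≤z v
... | no  _ = ℚ.≤-refl

average-nonNeg : ∀ {n} {G : Graph (Fin n)} (S : ConnectedSet G) {z} → NonNeg z → NonNeg (average S z)
average-nonNeg S {z} 0≤z v with v ∈? set S
... | no  _ = 0≤z v
... | yes _ = *-nonNeg (ℚ.nonNegative⁻¹ 1/s {{1/s≥0}}) (sum-nonNeg (restrict-nonNeg (set S) 0≤z))
  where
  1/s   = (+ 1 / ∣ set S ∣) {{nonempty⇒nonZero (nonempty S)}}
  1/s≥0 = ℚ.normalize-nonNeg 1 ∣ set S ∣ {{nonempty⇒nonZero (nonempty S)}}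

-- The sum of the coefficients of a functional over a subset.
total : ∀ {n} → Subset n → Functional n → ℕ
total []            []      = 0
total (inside  ∷ T) (k ∷ p) = k ℕ.+ total T p
total (outside ∷ T) (_ ∷ p) = total T p

-- Replaces the coefficients on T by t, and multiplies the others by s.
overwrite : ∀ {n} → ℕ → ℕ → Subset n → Functional n → Functional n
overwrite s t = zipWith (λ i k → if i then t else s ℕ.* k)

-- Averaging is self-adjoint, so p pulls back along the averaging over T to the
-- average of p over T. Multiplying by the size of T keeps the coefficients
-- natural.
pullback : ∀ {n} → Subset n → Functional n → Functional n
pullback T p = overwrite ∣ T ∣ (total T p) T p

ι-total : ∀ {n} (T : Subset n) p → ι (total T p) ≡ sum (restrict T (ι ∘ lookup p))
ι-total []      []      = refl
ι-total (i ∷ T) (k ∷ p) = trans (first i) (cong (_+_ (restrict (i ∷ T) (ι ∘ lookup (k ∷ p)) zero)) (trans (ι-total T p) (sum-cong-≗ later)))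
  where
  first : ∀ i → ι (total (i ∷ T) (k ∷ p)) ≡ restrict (i ∷ T) (ι ∘ lookup (k ∷ p)) zero + ι (total T p)
  first inside  = ι-+ k (total T p)
  first outside = sym (ℚ.+-identityˡ _)
  later : ∀ v → restrict T (ι ∘ lookup p) v ≡ restrict (i ∷ T) (ι ∘ lookup (k ∷ p)) (suc v)
  later v with v ∈? T
  ... | yes _ = refl
  ... | no  _ = refl

lookup-∉ : ∀ {n} {T : Subset n} {v} → v ∉ T → lookup T v ≡ outside
lookup-∉ {T = T} {v} v∉T with lookup T v in eq
... | outside = refl
... | inside  = contradiction (lookup⇒[]= v T eq) v∉T

-- On both sides, the vertices of S contribute the product of the sum of p and the
-- sum of z over S, and every other vertex v contributes |S| p_v z_v.
average-dual : ∀ {n} {G : Graph (Fin n)} (S : ConnectedSet G) p z →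
  ι ∣ set S ∣ * (p · average S z) ≡ pullback (set S) p · z
average-dual {n} S p z = begin
  ι s * (p · average S z)                              ≡⟨ *-distribˡ-sum {n} (ι s) (λ v → p̂ v * average S z v) ⟩
  sum (λ v → ι s * (p̂ v * average S z v))              ≡⟨ sum-cong-≗ left ⟩
  sum (λ v → restrict T p̂ v * Z + away v)              ≡⟨ ∑-distrib-+ (λ v → restrict T p̂ v * Z) away ⟩
  sum (λ v → restrict T p̂ v * Z) + sum away            ≡⟨ cong (_+ sum away) (*-distribʳ-sum {n} Z (restrict T p̂)) ⟨
  P * Z + sum away                                     ≡⟨ cong (_+ sum away) (*-distribˡ-sum {n} P (restrict T z)) ⟩
  sum (λ v → P * restrict T z v) + sum away            ≡⟨ ∑-distrib-+ (λ v → P * restrict T z v) away ⟨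
  sum (λ v → P * restrict T z v + away v)              ≡⟨ sum-cong-≗ right ⟨
  pullback T p · z                                     ∎
  where
  open ≡-Reasoning
  T = set S
  s = ∣ T ∣
  p̂ = ι ∘ lookup p
  P = sum (restrict T p̂)
  Z = sum (restrict T z)
  away : Weights _
  away v with v ∈? T
  ... | yes _ = 0ℚ
  ... | no  _ = ι s * (p̂ v * z v)
  left : ∀ v → ι s * (p̂ v * average S z v) ≡ restrict T p̂ v * Z + away v
  left v with v ∈? T
  ... | no  _ = sym (trans (cong (_+ ι s * (p̂ v * z v)) (ℚ.*-zeroˡ Z)) (ℚ.+-identityˡ _))
  ... | yes _ = begin
    ι s * (p̂ v * (1/s * Z))   ≡⟨ solve 4 (λ s p r Z → s :* (p :* (r :* Z)) := (s :* r) :* (p :* Z)) refl (ι s) (p̂ v) 1/s Z ⟩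
    (ι s * 1/s) * (p̂ v * Z)   ≡⟨ cong (_* (p̂ v * Z)) (ι-*-1/ s {{s≢0}}) ⟩
    1ℚ * (p̂ v * Z)            ≡⟨ ℚ.*-identityˡ _ ⟩
    p̂ v * Z                   ≡⟨ ℚ.+-identityʳ _ ⟨
    p̂ v * Z + 0ℚ              ∎
    where
    open +-*-Solver
    s≢0 = nonempty⇒nonZero (nonempty S)
    1/s = (+ 1 / s) {{s≢0}}
  right : ∀ v → ι (lookup (pullback T p) v) * z v ≡ P * restrict T z v + away v
  right v rewrite lookup-zipWith (λ i k → if i then total T p else s ℕ.* k) v T p with v ∈? T
  ... | yes v∈T rewrite []=⇒lookup v∈T | ι-total T p = sym (ℚ.+-identityʳ _)
  ... | no  v∉T rewrite lookup-∉ v∉T = begin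
    ι (s ℕ.* lookup p v) * z v         ≡⟨ cong (_* z v) (ι-* s (lookup p v)) ⟩
    (ι s * p̂ v) * z v                  ≡⟨ ℚ.*-assoc (ι s) (p̂ v) (z v) ⟩
    ι s * (p̂ v * z v)                  ≡⟨ ℚ.+-identityˡ _ ⟨
    0ℚ + ι s * (p̂ v * z v)             ≡⟨ cong (_+ ι s * (p̂ v * z v)) (ℚ.*-zeroʳ P) ⟨
    P * 0ℚ + ι s * (p̂ v * z v)         ∎

-- Domination of functionals, and families preserved by averaging

infixl 6 _⊕_
infixl 7 _⊛_
infix  4 _≼_ _≼?_

_⊕_ : ∀ {n} → Functional n → Functional n → Functional n
_⊕_ = zipWith ℕ._+_

_⊛_ : ∀ {n} → ℕ → Functional n → Functional n
k ⊛ p = Vec.map (k ℕ.*_) p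

_≼_ : ∀ {n} → Functional n → Functional n → Set
_≼_ = Pointwise _≤_

_≼?_ : ∀ {n} (p r : Functional n) → Dec (p ≼ r)
_≼?_ = Pointwise.decidable ℕ._≤?_

⊕-· : ∀ {n} (p r : Functional n) z → (p ⊕ r) · z ≡ p · z + r · z
⊕-· p r z = trans (sum-cong-≗ pointwise) (∑-distrib-+ (λ v → ι (lookup p v) * z v) (λ v → ι (lookup r v) * z v))
  where
  open ≡-Reasoning
  pointwise : ∀ v → ι (lookup (p ⊕ r) v) * z v ≡ ι (lookup p v) * z v + ι (lookup r v) * z v
  pointwise v = begin
    ι (lookup (p ⊕ r) v) * z v                      ≡⟨ cong (λ k → ι k * z v) (lookup-zipWith ℕ._+_ v p r) ⟩
    ι (lookup p v ℕ.+ lookup r v) * z v             ≡⟨ cong (_* z v) (ι-+ (lookup p v) (lookup r v)) ⟩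
    (ι (lookup p v) + ι (lookup r v)) * z v         ≡⟨ ℚ.*-distribʳ-+ (z v) (ι (lookup p v)) (ι (lookup r v)) ⟩
    ι (lookup p v) * z v + ι (lookup r v) * z v     ∎

⊛-· : ∀ {n} k (p : Functional n) z → (k ⊛ p) · z ≡ ι k * (p · z)
⊛-· {n} k p z = trans (sum-cong-≗ pointwise) (sym (*-distribˡ-sum {n} (ι k) (λ v → ι (lookup p v) * z v)))
  where
  open ≡-Reasoning
  pointwise : ∀ v → ι (lookup (k ⊛ p) v) * z v ≡ ι k * (ι (lookup p v) * z v)
  pointwise v = begin
    ι (lookup (k ⊛ p) v) * z v        ≡⟨ cong (λ l → ι l * z v) (lookup-map v (k ℕ.*_) p) ⟩
    ι (k ℕ.* lookup p v) * z v        ≡⟨ cong (_* z v) (ι-* k (lookup p v)) ⟩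
    ι k * ι (lookup p v) * z v        ≡⟨ ℚ.*-assoc (ι k) (ι (lookup p v)) (z v) ⟩
    ι k * (ι (lookup p v) * z v)      ∎

≼-· : ∀ {n} {p r : Functional n} {z} → NonNeg z → p ≼ r → p · z ℚ.≤ r · z
≼-· {z = z} 0≤z p≼r = sum-mono-≤ λ v →
  ℚ.*-monoʳ-≤-nonNeg (z v) {{ℚ.nonNegative (0≤z v)}} (ι-mono-≤ (Pointwise.lookup p≼r v))

-- Every functional of the family is at most m at z.
Below : ∀ {n} → List (Functional n) → Weights n → ℚ → Set
Below F z m = All (λ p → p · z ℚ.≤ m) F

-- Two functionals are mixed with weights 1 : k; these are the values of k that
-- the families below need.
ratios : List ℕ
ratios = 1 ∷ 2 ∷ 3 ∷ 8 ∷ []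

-- The functional v / s lies coefficientwise below a member of F, or below a
-- mixture (p + k r) / (1 + k) of two members.
Dominated : ∀ {n} → List (Functional n) → ℕ → Functional n → Set
Dominated F s v =
    Any (λ p → v ≼ s ⊛ p) F
  ⊎ Any (λ p → Any (λ r → Any (λ k → suc k ⊛ v ≼ s ⊛ (p ⊕ k ⊛ r)) ratios) F) F

dominated? : ∀ {n} F s (v : Functional n) → Dec (Dominated F s v)
dominated? F s v =
        Any.any? (λ p → v ≼? s ⊛ p) F
  ⊎-dec Any.any? (λ p → Any.any? (λ r → Any.any? (λ k → suc k ⊛ v ≼? s ⊛ (p ⊕ k ⊛ r)) ratios) F) F

dominated-· : ∀ {n} {F} s {v : Functional n} {z m} →
  NonNeg z → Below F z m → Dominated F s v → v · z ℚ.≤ ι s * m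
dominated-· s {v} {z} {m} 0≤z F≤m (inj₁ single) = begin
  v · z            ≤⟨ ≼-· {p = v} 0≤z v≼sp ⟩
  (s ⊛ p) · z      ≡⟨ ⊛-· s p z ⟩
  ι s * (p · z)    ≤⟨ ℚ.*-monoˡ-≤-nonNeg (ι s) {{ι-nonNeg s}} (All.lookup F≤m p∈F) ⟩
  ι s * m          ∎
  where
  open ℚ.≤-Reasoning
  p    = proj₁ (find single)
  p∈F  = proj₁ (proj₂ (find single))
  v≼sp = proj₂ (proj₂ (find single))
dominated-· s {v} {z} {m} 0≤z F≤m (inj₂ mixture)
  with p , p∈F , mixture′ ← find mixture
  with r , r∈F , mixture″ ← find mixture′
  with k , _ , v≼mix ← find mixture″ =
  ℚ.*-cancelˡ-≤-pos (ι (suc k)) {{ι-pos (suc k)}} (begin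
    ι (suc k) * (v · z)                    ≡⟨ ⊛-· (suc k) v z ⟨
    (suc k ⊛ v) · z                        ≤⟨ ≼-· {p = suc k ⊛ v} 0≤z v≼mix ⟩
    (s ⊛ (p ⊕ k ⊛ r)) · z                  ≡⟨ ⊛-· s (p ⊕ k ⊛ r) z ⟩
    ι s * ((p ⊕ k ⊛ r) · z)                ≡⟨ cong (ι s *_) (trans (⊕-· p (k ⊛ r) z) (cong (_+_ (p · z)) (⊛-· k r z))) ⟩
    ι s * (p · z + ι k * (r · z))          ≤⟨ ℚ.*-monoˡ-≤-nonNeg (ι s) {{ι-nonNeg s}}
                                                (ℚ.+-mono-≤ (All.lookup F≤m p∈F)
                                                  (ℚ.*-monoˡ-≤-nonNeg (ι k) {{ι-nonNeg k}} (All.lookup F≤m r∈F))) ⟩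
    ι s * (m + ι k * m)                    ≡⟨ solve 3 (λ s m k → s :* (m :+ k :* m) := (con 1ℚ :+ k) :* (s :* m)) refl (ι s) m (ι k) ⟩
    (1ℚ + ι k) * (ι s * m)                 ≡⟨ cong (_* (ι s * m)) (ι-+ 1 k) ⟨
    ι (suc k) * (ι s * m)                  ∎)
  where
  open ℚ.≤-Reasoning
  open +-*-Solver

-- Along every set of 𝓢, each functional of F pulls back to one that is dominated
-- by F′ together with the auxiliary family H, where H is itself dominated by F′.
-- The members of H are thus available for mixtures of more than two members of
-- F′, but their own pullbacks are unconstrained.
Preserved : ∀ {n} → List (Subset n) → (F H F′ : List (Functional n)) → Set
Preserved 𝓢 F H F′ =
    All (Dominated F′ 1) H
  × All (λ T → All (λ p → Dominated (F′ ++ H) ∣ T ∣ (pullback T p)) F) 𝓢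

preserved? : ∀ {n} (𝓢 : List (Subset n)) F H F′ → Dec (Preserved 𝓢 F H F′)
preserved? 𝓢 F H F′ =
        All.all? (dominated? F′ 1) H
  ×-dec All.all? (λ T → All.all? (λ p → dominated? (F′ ++ H) ∣ T ∣ (pullback T p)) F) 𝓢

-- Both sides of the hypothesis carry the factor |S| that clears denominators.
pullback-≤ : ∀ {n} {G : Graph (Fin n)} (S : ConnectedSet G) p {z m} →
  pullback (set S) p · z ℚ.≤ ι ∣ set S ∣ * m → p · average S z ℚ.≤ m
pullback-≤ S p {z} bound = ℚ.*-cancelˡ-≤-pos (ι ∣ set S ∣) {{ι-pos ∣ set S ∣ {{nonempty⇒nonZero (nonempty S)}}}}
  (subst (ℚ._≤ _) (sym (average-dual S p z)) bound)

below-average : ∀ {n} {G : Graph (Fin n)} {𝓢 F H F′} (S : ConnectedSet G) {z m} →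
  Preserved 𝓢 F H F′ → set S List.∈ 𝓢 → NonNeg z → Below F′ z m → Below F (average S z) m
below-average {H = H} S {z} {m} (H-dominated , F-dominated) S∈𝓢 0≤z F′≤m =
  All.map (λ {p} dom → pullback-≤ S p (dominated-· ∣ set S ∣ 0≤z (All.++⁺ F′≤m H≤m) dom)) (All.lookup F-dominated S∈𝓢)
  where
  H≤m : Below H z m
  H≤m = All.map (λ {p} dom → ℚ.≤-trans (dominated-· 1 0≤z F′≤m dom) (ℚ.≤-reflexive (ℚ.*-identityˡ m))) H-dominated

-- The first averaging of σ acts on z first, so the family indexed by the number
-- of remaining steps decreases to F 0.
below-operator : ∀ {n} {G : Graph (Fin n)} {𝓢 H} (F : ℕ → List (Functional n)) →
  (∀ k → Preserved 𝓢 (F k) H (F (suc k))) →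
  (σ : Strategy G) → All (λ S → set S List.∈ 𝓢) σ →
  ∀ {z m} → NonNeg z → Below (F (length σ)) z m → Below (F 0) (operator σ z) m
below-operator F preserved []      []           0≤z F≤m = F≤m
below-operator F preserved (S ∷ σ) (S∈𝓢 ∷ σ∈𝓢) 0≤z F≤m =
  below-operator F preserved σ σ∈𝓢 (average-nonNeg S 0≤z)
    (below-average S (preserved (length σ)) S∈𝓢 0≤z F≤m)

-- The connected sets of the example

open Example

_≟ˢ_ : (S T : Subset 5) → Dec (S ≡ T)
_≟ˢ_ = ≡-dec Bool._≟_

open DecMembership _≟ˢ_ using () renaming (_∈?_ to _∈ˡ?_)

xc-set xd-set : Subset 5
xc-set = ⁅ x ⁆ ∪ ⁅ c ⁆
xd-set = ⁅ x ⁆ ∪ ⁅ d ⁆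

-- The nontrivial connected sets are listed apart from the singletons, and the two
-- edges at the target apart from the rest.
singletons otherSets connectedSets : List (Subset 5)
singletons = map ⁅_⁆ (allFin 5)
otherSets =
    ⁅ a ⁆ ∪ ⁅ b ⁆
  ∷ ⁅ b ⁆ ∪ ⁅ c ⁆
  ∷ ⁅ b ⁆ ∪ ⁅ d ⁆
  ∷ ⁅ a ⁆ ∪ ⁅ b ⁆ ∪ ⁅ c ⁆
  ∷ ⁅ a ⁆ ∪ ⁅ b ⁆ ∪ ⁅ d ⁆
  ∷ ⁅ b ⁆ ∪ ⁅ x ⁆ ∪ ⁅ c ⁆
  ∷ ⁅ b ⁆ ∪ ⁅ x ⁆ ∪ ⁅ d ⁆
  ∷ ⁅ b ⁆ ∪ ⁅ c ⁆ ∪ ⁅ d ⁆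
  ∷ ⁅ x ⁆ ∪ ⁅ c ⁆ ∪ ⁅ d ⁆
  ∷ ⁅ a ⁆ ∪ ⁅ b ⁆ ∪ ⁅ x ⁆ ∪ ⁅ c ⁆
  ∷ ⁅ a ⁆ ∪ ⁅ b ⁆ ∪ ⁅ x ⁆ ∪ ⁅ d ⁆
  ∷ ⁅ a ⁆ ∪ ⁅ b ⁆ ∪ ⁅ c ⁆ ∪ ⁅ d ⁆
  ∷ ⁅ b ⁆ ∪ ⁅ x ⁆ ∪ ⁅ c ⁆ ∪ ⁅ d ⁆
  ∷ ⁅ a ⁆ ∪ ⁅ b ⁆ ∪ ⁅ x ⁆ ∪ ⁅ c ⁆ ∪ ⁅ d ⁆
  ∷ []
connectedSets = singletons ++ xc-set ∷ xd-set ∷ otherSets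

edges : List (V × V)
edges = (a , b) ∷ (b , c) ∷ (b , d) ∷ (x , c) ∷ (x , d) ∷ []

edge∈edges : ∀ {u v} → Edge u v → (u , v) List.∈ edges
edge∈edges ab = here refl
edge∈edges bc = there (here refl)
edge∈edges bd = there (there (here refl))
edge∈edges xc = there (there (there (here refl)))
edge∈edges xd = there (there (there (there (here refl))))

-- If both ends of the edge lie in S, then they lie on the same side of T.
Uncrossed : Subset 5 → Subset 5 → V × V → Set
Uncrossed S T (u , v) = u ∈ S → v ∈ S → lookup T u ≡ lookup T v

-- T splits S into two nonempty parts without an edge between them.
Separates : Subset 5 → Subset 5 → Set
Separates S T =
  (∃[ u ] u ∈ S × lookup T u ≡ inside) × (∃[ v ] v ∈ S × lookup T v ≡ outside) × All (Uncrossed S T) edges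

separates? : ∀ S T → Dec (Separates S T)
separates? S T =
        Fin.any? (λ u → u ∈? S ×-dec lookup T u Bool.≟ inside)
  ×-dec Fin.any? (λ v → v ∈? S ×-dec lookup T v Bool.≟ outside)
  ×-dec All.all? (λ (u , v) → u ∈? S →-dec (v ∈? S →-dec lookup T u Bool.≟ lookup T v)) edges

separates⇒disconnected : ∀ {S T} → Separates S T → ¬ IsConnected (induced G (_∈ S))
separates⇒disconnected {S} {T} ((u , u∈S , Tu) , (v , v∈S , Tv) , uncrossed) connected =
  contradiction (trans (sym Tu) (trans (along (connected (u , u∈S) (v , v∈S))) Tv)) λ ()
  where
  along : ∀ {s t} → Star (Graph.Adj (induced G (_∈ S))) s t → lookup T (proj₁ s) ≡ lookup T (proj₁ t)
  along ε = refl
  along {_ , s∈S} (_◅_ {j = _ , t∈S} (fwd e) path) =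
    trans (All.lookup uncrossed (edge∈edges e) s∈S t∈S) (along path)
  along {_ , s∈S} (_◅_ {j = _ , t∈S} (bwd e) path) =
    trans (sym (All.lookup uncrossed (edge∈edges e) t∈S s∈S)) (along path)

-- The three alternatives are decidable, and a search through all 32 subsets shows
-- that one of them always holds.
Classified : Subset 5 → Set
Classified S = Empty S ⊎ S List.∈ connectedSets ⊎ ∃ (Separates S)

classify : ∀ S → Classified S
classify S = decidable-stable (classified? S) λ ¬c → from-no (anySubset? (¬? ∘ classified?)) (S , ¬c)
  where
  classified? : ∀ S → Dec (Classified S)
  classified? S = ¬? (nonempty? S) ⊎-dec (S ∈ˡ? connectedSets) ⊎-dec anySubset? (separates? S)

set∈connectedSets : (S : ConnectedSet G) → set S List.∈ connectedSets
set∈connectedSets S with classify (set S)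
... | inj₁ empty                  = contradiction (nonempty S) empty
... | inj₂ (inj₁ S∈)              = S∈
... | inj₂ (inj₂ (T , separates)) = contradiction (connected S) (separates⇒disconnected {T = T} separates)

-- Families of functionals for the example

-- The common denominator: a vector of coefficients p stands for the functional
-- p / D.
D : ℕ
D = 96

-- The bound on p · z that corresponds to the bound m on (p / D) · z.
scaled : ℚ → ℚ
scaled m = ι D * m

-- The weight of the target vertex, and a quarter of the total weight. Averaging
-- preserves the total weight 8 of ω, so the second functional always has the
-- value 2; with it, every functional whose coefficients are at most 1/4 is
-- dominated.
target quarters : Functional 5
target   = 0 ∷ 0 ∷ D ∷ 0 ∷ 0 ∷ []
quarters = 24 ∷ 24 ∷ 24 ∷ 24 ∷ 24 ∷ []

target-· : ∀ z → target · z ≡ ι D * z x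
target-· z = solve 5 (λ a b x c d →
    con 0ℚ :* a :+ (con 0ℚ :* b :+ (con (ι D) :* x :+ (con 0ℚ :* c :+ (con 0ℚ :* d :+ con 0ℚ)))) := con (ι D) :* x)
  refl (z a) (z b) (z x) (z c) (z d)
  where open +-*-Solver

target-≤ : ∀ {z m} → target · z ℚ.≤ scaled m → z x ℚ.≤ m
target-≤ {z} {m} bound = ℚ.*-cancelˡ-≤-pos (ι D) (subst (ℚ._≤ scaled m) (target-· z) bound)

-- The family with index k bounds the target after k averagings. The first four
-- have values at most 2 at ω; the two functionals added last have the value
-- 65/32 there, and the resulting family is preserved by all averagings.
family₀ family₁ family₂ family₃ family₄ : List (Functional 5)
family₀ = target ∷ quarters ∷ []
family₁ = family₀ ++
    ( 0 ∷  0 ∷ 48 ∷ 48 ∷  0 ∷ [])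
  ∷ ( 0 ∷  0 ∷ 48 ∷  0 ∷ 48 ∷ [])
  ∷ ( 0 ∷ 32 ∷ 32 ∷ 32 ∷  0 ∷ [])
  ∷ ( 0 ∷ 32 ∷ 32 ∷  0 ∷ 32 ∷ [])
  ∷ ( 0 ∷  0 ∷ 24 ∷ 48 ∷ 24 ∷ [])
  ∷ []
family₂ = family₁ ++
    ( 0 ∷  0 ∷ 24 ∷ 24 ∷ 48 ∷ [])
  ∷ ( 0 ∷ 16 ∷ 16 ∷ 48 ∷ 16 ∷ [])
  ∷ ( 0 ∷ 16 ∷ 16 ∷ 16 ∷ 48 ∷ [])
  ∷ (12 ∷ 12 ∷ 12 ∷ 48 ∷ 12 ∷ [])
  ∷ (12 ∷ 12 ∷ 12 ∷ 12 ∷ 48 ∷ [])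
  ∷ ( 0 ∷ 32 ∷ 16 ∷ 32 ∷ 16 ∷ [])
  ∷ ( 0 ∷ 32 ∷ 16 ∷ 16 ∷ 32 ∷ [])
  ∷ []
family₃ = family₂ ++
    (12 ∷ 30 ∷ 12 ∷ 30 ∷ 12 ∷ [])
  ∷ (12 ∷ 30 ∷ 12 ∷ 12 ∷ 30 ∷ [])
  ∷ ( 0 ∷  0 ∷ 32 ∷ 32 ∷ 32 ∷ [])
  ∷ []
family₄ = family₃ ++
    (12 ∷ 30 ∷ 21 ∷ 21 ∷ 12 ∷ [])
  ∷ (12 ∷ 30 ∷ 21 ∷ 12 ∷ 21 ∷ [])
  ∷ []

family : ℕ → List (Functional 5)
family 0 = family₀
family 1 = family₁
family 2 = family₂
family 3 = family₃
family (suc (suc (suc (suc _)))) = family₄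

family-preserved : ∀ k → Preserved connectedSets (family k) [] (family (suc k))
family-preserved 0 = from-yes (preserved? connectedSets (family 0) [] (family 1))
family-preserved 1 = from-yes (preserved? connectedSets (family 1) [] (family 2))
family-preserved 2 = from-yes (preserved? connectedSets (family 2) [] (family 3))
family-preserved 3 = from-yes (preserved? connectedSets (family 3) [] (family 4))
family-preserved (suc (suc (suc (suc _)))) = from-yes (preserved? connectedSets (family 4) [] (family 4))

-- Families preserved by averaging over every connected set except {x,c},
-- respectively {x,d}. The four auxiliary functionals are mixtures of two members;
-- further mixing with a member dominates the few pullbacks that lie in the hull
-- of the family but below no mixture of two members.
family-xc aux-xc family-xd aux-xd : List (Functional 5)
family-xc =
    target
  ∷ quarters
  ∷ ( 0 ∷  0 ∷ 48 ∷  0 ∷ 48 ∷ [])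
  ∷ ( 0 ∷  0 ∷ 32 ∷ 32 ∷ 32 ∷ [])
  ∷ ( 0 ∷ 32 ∷ 32 ∷ 32 ∷  0 ∷ [])
  ∷ ( 0 ∷ 32 ∷ 32 ∷  0 ∷ 32 ∷ [])
  ∷ ( 0 ∷ 16 ∷ 16 ∷ 16 ∷ 48 ∷ [])
  ∷ (12 ∷ 12 ∷ 12 ∷ 12 ∷ 48 ∷ [])
  ∷ ( 0 ∷ 32 ∷ 16 ∷ 32 ∷ 16 ∷ [])
  ∷ (16 ∷ 16 ∷ 32 ∷ 32 ∷  0 ∷ [])
  ∷ (16 ∷ 16 ∷ 16 ∷ 32 ∷ 16 ∷ [])
  ∷ ( 8 ∷  8 ∷ 16 ∷ 16 ∷ 48 ∷ [])
  ∷ ( 0 ∷ 32 ∷ 16 ∷ 16 ∷ 32 ∷ [])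
  ∷ (16 ∷  8 ∷ 32 ∷ 32 ∷  8 ∷ [])
  ∷ ( 0 ∷ 24 ∷ 16 ∷ 32 ∷ 24 ∷ [])
  ∷ (12 ∷ 30 ∷ 12 ∷ 12 ∷ 30 ∷ [])
  ∷ (12 ∷ 12 ∷ 16 ∷ 32 ∷ 24 ∷ [])
  ∷ (16 ∷  8 ∷ 20 ∷ 32 ∷ 20 ∷ [])
  ∷ (12 ∷ 30 ∷ 21 ∷ 12 ∷ 21 ∷ [])
  ∷ (12 ∷ 30 ∷ 18 ∷ 18 ∷ 18 ∷ [])
  ∷ []
aux-xc =
    ( 0 ∷ 12 ∷ 24 ∷ 12 ∷ 48 ∷ [])
  ∷ ( 4 ∷ 20 ∷ 20 ∷ 32 ∷ 20 ∷ [])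
  ∷ (12 ∷ 12 ∷ 28 ∷ 32 ∷ 12 ∷ [])
  ∷ ( 0 ∷ 24 ∷ 48 ∷ 24 ∷  0 ∷ [])
  ∷ []

-- The symmetry of the graph that exchanges c and d.
mirror : Functional 5 → Functional 5
mirror (pa ∷ pb ∷ px ∷ pc ∷ pd ∷ []) = pa ∷ pb ∷ px ∷ pd ∷ pc ∷ []

family-xd = map mirror family-xc
aux-xd    = map mirror aux-xc

-- The connected sets other than T.
without : Subset 5 → List (Subset 5)
without T = filter (λ S → ¬? (T ≟ˢ S)) connectedSets

family-xc-preserved : Preserved (without xc-set) family-xc aux-xc family-xc
family-xc-preserved = from-yes (preserved? (without xc-set) family-xc aux-xc family-xc)

family-xd-preserved : Preserved (without xd-set) family-xd aux-xd family-xd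
family-xd-preserved = from-yes (preserved? (without xd-set) family-xd aux-xd family-xd)

-- Values at the initial weights

below? : ∀ (F : List (Functional 5)) z m → Dec (Below F z m)
below? F z m = All.all? (λ p → p · z ℚ.≤? m) F

ω-below : Below (family 4) ω (scaled (+ 65 / 32))
ω-below = from-yes (below? (family 4) ω (scaled (+ 65 / 32)))

ω-below-short : Below (family 3) ω (scaled (+ 2 / 1))
ω-below-short = from-yes (below? (family 3) ω (scaled (+ 2 / 1)))

-- For a connected set T, the functionals of F are at most 2 after averaging ω over
-- T. Stated through pullbacks, this needs no proof that T is connected.
AfterBelow : List (Functional 5) → Subset 5 → Set
AfterBelow F T = Below (map (pullback T) F) ω (ι ∣ T ∣ * scaled (+ 2 / 1))

afterBelow? : ∀ F T → Dec (AfterBelow F T)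
afterBelow? F T = below? (map (pullback T) F) ω (ι ∣ T ∣ * scaled (+ 2 / 1))

-- A first averaging over any nontrivial set other than {x,c} and {x,d} already
-- rules out every value above 2.
ω-after-other : All (AfterBelow (family 4)) otherSets
ω-after-other = from-yes (All.all? (afterBelow? (family 4)) otherSets)

ω-after-xc : AfterBelow family-xc xc-set
ω-after-xc = from-yes (afterBelow? family-xc xc-set)

ω-after-xd : AfterBelow family-xd xd-set
ω-after-xd = from-yes (afterBelow? family-xd xd-set)

family⊆family₄ : ∀ {P : Functional 5 → Set} k → All P family₄ → All P (family k)
family⊆family₄ 0 = All.++⁻ˡ family₀ ∘ All.++⁻ˡ family₁ ∘ All.++⁻ˡ family₂ ∘ All.++⁻ˡ family₃
family⊆family₄ 1 = All.++⁻ˡ family₁ ∘ All.++⁻ˡ family₂ ∘ All.++⁻ˡ family₃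
family⊆family₄ 2 = All.++⁻ˡ family₂ ∘ All.++⁻ˡ family₃
family⊆family₄ 3 = All.++⁻ˡ family₃
family⊆family₄ (suc (suc (suc (suc _)))) ps = ps

ω-below-family<4 : ∀ {k} → k ℕ.< 4 → Below (family k) ω (scaled (+ 2 / 1))
ω-below-family<4 {0} _ = All.++⁻ˡ family₀ (All.++⁻ˡ family₁ (All.++⁻ˡ family₂ ω-below-short))
ω-below-family<4 {1} _ = All.++⁻ˡ family₁ (All.++⁻ˡ family₂ ω-below-short)
ω-below-family<4 {2} _ = All.++⁻ˡ family₂ ω-below-short
ω-below-family<4 {3} _ = ω-below-short
ω-below-family<4 {suc (suc (suc (suc _)))} (s≤s (s≤s (s≤s (s≤s ()))))

ω-nonNeg : NonNeg ω
ω-nonNeg = from-yes (Fin.all? (λ v → 0ℚ ℚ.≤? ω v))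

operator-≤ : ∀ σ {z m} → NonNeg z → Below (family (length σ)) z (scaled m) → operator σ z x ℚ.≤ m
operator-≤ σ 0≤z bound = target-≤ {z = operator σ _} (All.head
  (below-operator family family-preserved σ (All.universal set∈connectedSets σ) 0≤z bound))

final-≤-65/32 : ∀ σ → final σ ℚ.≤ + 65 / 32
final-≤-65/32 σ = operator-≤ σ ω-nonNeg (family⊆family₄ (length σ) ω-below)

final-≤-2-of-short : ∀ σ → length σ ℕ.< 4 → final σ ℚ.≤ + 2 / 1
final-≤-2-of-short σ short = operator-≤ σ ω-nonNeg (ω-below-family<4 short)

-- Averaging over a singleton

-- Equality of weights as seen by functionals. Averaging over a singleton changes
-- nothing in this sense.
_≈_ : Weights 5 → Weights 5 → Set
z ≈ w = ∀ p → p · z ≡ p · w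

total-⊥ : ∀ {n} (p : Functional n) → total ⊥ p ≡ 0
total-⊥ []      = refl
total-⊥ (_ ∷ p) = total-⊥ p

total-singleton : ∀ {n} (i : Fin n) p → total ⁅ i ⁆ p ≡ lookup p i
total-singleton zero    (k ∷ p) = trans (cong (k ℕ.+_) (total-⊥ p)) (ℕ.+-identityʳ k)
total-singleton (suc i) (_ ∷ p) = total-singleton i p

overwrite-⊥ : ∀ {n} t (p : Functional n) → overwrite 1 t ⊥ p ≡ p
overwrite-⊥ t []      = refl
overwrite-⊥ t (k ∷ p) = cong₂ _∷_ (ℕ.*-identityˡ k) (overwrite-⊥ t p)

overwrite-singleton : ∀ {n} (i : Fin n) p → overwrite 1 (lookup p i) ⁅ i ⁆ p ≡ p
overwrite-singleton zero    (k ∷ p) = cong (k ∷_) (overwrite-⊥ k p)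
overwrite-singleton (suc i) (k ∷ p) = cong₂ _∷_ (ℕ.*-identityˡ k) (overwrite-singleton i p)

pullback-singleton : ∀ {n} (i : Fin n) p → pullback ⁅ i ⁆ p ≡ p
pullback-singleton i p rewrite ∣⁅x⁆∣≡1 i | total-singleton i p = overwrite-singleton i p

average-singleton : ∀ (S : ConnectedSet G) i z → set S ≡ ⁅ i ⁆ → average S z ≈ z
average-singleton S i z S≡i p = begin
  p · average S z                      ≡⟨ ℚ.*-identityˡ _ ⟨
  ι 1 * (p · average S z)              ≡⟨ cong (λ s → ι s * (p · average S z)) (trans (cong ∣_∣ S≡i) (∣⁅x⁆∣≡1 i)) ⟨
  ι ∣ set S ∣ * (p · average S z)      ≡⟨ average-dual S p z ⟩
  pullback (set S) p · z               ≡⟨ cong (_· z) (trans (cong (λ T → pullback T p) S≡i) (pullback-singleton i p)) ⟩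
  p · z                                ∎
  where open ≡-Reasoning

below-after : ∀ (S : ConnectedSet G) {T F z} → set S ≡ T → z ≈ ω →
  AfterBelow F T → Below F (average S z) (scaled (+ 2 / 1))
below-after S {T} {z = z} S≡T z≈ω after = All.map (λ {p} → below p) (All.map⁻ after)
  where
  m = scaled (+ 2 / 1)
  below : ∀ p → pullback T p · ω ℚ.≤ ι ∣ T ∣ * m → p · average S z ℚ.≤ m
  below p bound = pullback-≤ S p (subst (λ T → pullback T p · z ℚ.≤ ι ∣ T ∣ * m) (sym S≡T)
    (subst (ℚ._≤ ι ∣ T ∣ * m) (sym (z≈ω (pullback T p))) bound))

-- Repeated sets

module _ {n} {G : Graph (Fin n)} where

  occurrences-here : ∀ (S : ConnectedSet G) σ → occurrences (set S) (S ∷ σ) ≡ suc (occurrences (set S) σ)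
  occurrences-here S σ with ≡-dec Bool._≟_ (set S) (set S)
  ... | yes _  = refl
  ... | no S≢S = contradiction refl S≢S

  occurrences-∷ : ∀ T (S : ConnectedSet G) σ → occurrences T σ ≤ occurrences T (S ∷ σ)
  occurrences-∷ T S σ with ≡-dec Bool._≟_ T (set S)
  ... | yes _ = ℕ.n≤1+n _
  ... | no  _ = ℕ.≤-refl

  occurrences≡0⇒avoids : ∀ T (σ : Strategy G) → occurrences T σ ≡ 0 → All (λ S → T ≢ set S) σ
  occurrences≡0⇒avoids T []      _ = []
  occurrences≡0⇒avoids T (S ∷ σ) none with ≡-dec Bool._≟_ T (set S)
  ... | no T≢S = T≢S ∷ occurrences≡0⇒avoids T σ none

  avoids⇒occurrences≡0 : ∀ T (σ : Strategy G) → All (λ S → T ≢ set S) σ → occurrences T σ ≡ 0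
  avoids⇒occurrences≡0 T σ avoids = cong length (filter-none (≡-dec Bool._≟_ T) (All.map⁺ avoids))

  repetitionFree-tail : ∀ (S : ConnectedSet G) σ → RepetitionFree (S ∷ σ) → RepetitionFree σ
  repetitionFree-tail S₀ σ free S nontrivial = ℕ.≤-trans (occurrences-∷ (set S) S₀ σ) (free S nontrivial)

  repetitionFree-avoids : ∀ (S : ConnectedSet G) σ → RepetitionFree (S ∷ σ) → Nontrivial (set S) →
    All (λ S′ → set S ≢ set S′) σ
  repetitionFree-avoids S σ free nontrivial = occurrences≡0⇒avoids (set S) σ
    (ℕ.n≤0⇒n≡0 (ℕ.≤-pred (subst (_≤ 1) (occurrences-here S σ) (free S nontrivial))))

  -- Occurrences are compared as subsets, so it suffices to search σ itself for a
  -- set that occurs twice: a subset that occurs at all is the set of a member of σ.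
  repetition : (σ : Strategy G) → ¬ RepetitionFree σ →
    ∃[ S ] Nontrivial (set {G = G} S) × 2 ≤ occurrences (set S) σ
  repetition σ ¬free with Any.any? (λ S → 2 ℕ.≤? ∣ set S ∣ ×-dec 2 ℕ.≤? occurrences (set S) σ) σ
  ... | yes repeated = let S , _ , nontrivial , twice = find repeated in S , nontrivial , twice
  ... | no ¬repeated = contradiction free ¬free
    where
    free : RepetitionFree σ
    free S nontrivial with occurrences (set S) σ ℕ.≤? 1
    ... | yes once = once
    ... | no ¬once = contradiction (ℕ.≤-trans (ℕ.≤-reflexive never) z≤n) ¬once
      where
      never : occurrences (set S) σ ≡ 0
      never = avoids⇒occurrences≡0 (set S) σ (All.tabulate λ S′∈σ S≡S′ → ¬repeated (lose S′∈σ
        (subst (λ T → Nontrivial T × 2 ≤ occurrences T σ) S≡S′ (nontrivial , ℕ.≰⇒> ¬once))))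

avoids⇒∈without : ∀ {T} {σ : Strategy G} → All (λ S → T ≢ set S) σ → All (λ S → set S List.∈ without T) σ
avoids⇒∈without {T} = All.map λ {S} T≢S → ∈-filter⁺ (λ S → ¬? (T ≟ˢ S)) (set∈connectedSets S) T≢S

-- The bound for repetition-free strategies

-- Singletons are skipped. The first nontrivial set either rules out values above
-- 2, or is one of {x,c} and {x,d}; in the latter case that set is no longer
-- available, and the family preserved by the other sets applies.
repetitionFree-≤-2 : ∀ σ {z} → NonNeg z → z ≈ ω → RepetitionFree σ → operator σ z x ℚ.≤ + 2 / 1
repetitionFree-≤-2 []      {z} 0≤z z≈ω _ =
  target-≤ {z} (subst (ℚ._≤ scaled (+ 2 / 1)) (sym (z≈ω target)) (All.head ω-below-short))
repetitionFree-≤-2 (S ∷ σ) {z} 0≤z z≈ω free with ∈-++⁻ singletons (set∈connectedSets S)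
... | inj₁ S∈singletons =
  let i , _ , S≡i = ∈-map⁻ ⁅_⁆ {xs = allFin 5} S∈singletons in
  repetitionFree-≤-2 σ (average-nonNeg S 0≤z)
    (λ p → trans (average-singleton S i z S≡i p) (z≈ω p))
    (repetitionFree-tail S σ free)
... | inj₂ (here S≡xc) = target-≤ {operator σ (average S z)} (All.head
  (below-operator (const family-xc) (const family-xc-preserved) σ
    (avoids⇒∈without (subst (λ T → All (λ S′ → T ≢ set S′) σ) S≡xc
      (repetitionFree-avoids S σ free (subst Nontrivial (sym S≡xc) (s≤s (s≤s z≤n))))))
    (average-nonNeg S 0≤z) (below-after S S≡xc z≈ω ω-after-xc)))
... | inj₂ (there (here S≡xd)) = target-≤ {operator σ (average S z)} (All.head
  (below-operator (const family-xd) (const family-xd-preserved) σ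
    (avoids⇒∈without (subst (λ T → All (λ S′ → T ≢ set S′) σ) S≡xd
      (repetitionFree-avoids S σ free (subst Nontrivial (sym S≡xd) (s≤s (s≤s z≤n))))))
    (average-nonNeg S 0≤z) (below-after S S≡xd z≈ω ω-after-xd)))
... | inj₂ (there (there S∈others)) =
  operator-≤ σ (average-nonNeg S 0≤z)
    (family⊆family₄ (length σ) (below-after S refl z≈ω (All.lookup ω-after-other S∈others)))

final-≤-2-of-repetitionFree : ∀ σ → RepetitionFree σ → final σ ℚ.≤ + 2 / 1
final-≤-2-of-repetitionFree σ = repetitionFree-≤-2 σ ω-nonNeg (λ _ → refl)

-- Extremal strategies

-- Every vertex of S has a path to the root inside S.
RootedAt : (S : Subset 5) → ∃ (_∈ S) → Set
RootedAt S root = ∀ u → Star (Graph.Adj (induced G (_∈ S))) u root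

rooted⇒connected : ∀ S {root} → RootedAt S root → IsConnected (induced G (_∈ S))
rooted⇒connected S path u v = path u ◅◅ reverse (λ {s t} → Graph.Adj-sym (induced G (_∈ S)) {s} {t}) (path v)

bd-set bxc-set abxc-set : Subset 5
bd-set   = ⁅ b ⁆ ∪ ⁅ d ⁆
bxc-set  = ⁅ b ⁆ ∪ ⁅ x ⁆ ∪ ⁅ c ⁆
abxc-set = ⁅ a ⁆ ∪ ⁅ b ⁆ ∪ ⁅ x ⁆ ∪ ⁅ c ⁆

XD BD BXC ABXC : ConnectedSet G
XD = connectedSet xd-set root (rooted⇒connected xd-set path)
  where
  root = x , there (there here)
  path : RootedAt xd-set root
  path (a , ())
  path (b , there ())
  path (x , there (there here))                 = ε
  path (c , there (there (there ())))
  path (d , there (there (there (there here)))) = bwd xd ◅ ε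
BD = connectedSet bd-set root (rooted⇒connected bd-set path)
  where
  root = b , there here
  path : RootedAt bd-set root
  path (a , ())
  path (b , there here)                         = ε
  path (x , there (there ()))
  path (c , there (there (there ())))
  path (d , there (there (there (there here)))) = bwd bd ◅ ε
BXC = connectedSet bxc-set root (rooted⇒connected bxc-set path)
  where
  root = c , there (there (there here))
  path : RootedAt bxc-set root
  path (a , ())
  path (b , there here)                 = fwd bc ◅ ε
  path (x , there (there here))         = fwd xc ◅ ε
  path (c , there (there (there here))) = ε
  path (d , there (there (there (there ()))))
ABXC = connectedSet abxc-set root (rooted⇒connected abxc-set path)
  where
  root = c , there (there (there here))
  path : RootedAt abxc-set root
  path (a , here)                       = fwd ab ◅ path (b , there here)
  path (b , there here)                 = fwd bc ◅ ε
  path (x , there (there here))         = fwd xc ◅ ε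
  path (c , there (there (there here))) = ε
  path (d , there (there (there (there ()))))

optimal : Strategy G
optimal = XD ∷ BD ∷ ABXC ∷ XD ∷ []

optimal-final : final optimal ≡ + 65 / 32
optimal-final = refl

BXC-final : final (BXC ∷ []) ≡ + 2 / 1
BXC-final = refl

BXC-repetitionFree : RepetitionFree (BXC ∷ [])
BXC-repetitionFree S _ = length-filter (≡-dec Bool._≟_ (set S)) (map set (BXC ∷ []))

65/32≰2 : ¬ (+ 65 / 32 ℚ.≤ + 2 / 1)
65/32≰2 = from-no (+ 65 / 32 ℚ.≤? + 2 / 1)

optimal⇒¬≤2 : ∀ σ → Optimal σ → ¬ (final σ ℚ.≤ + 2 / 1)
optimal⇒¬≤2 σ optimal final≤2 = 65/32≰2 (subst (ℚ._≤ + 2 / 1) optimal final≤2)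

theorem1p3 : IsMaximum U Example.final (+ 65 / 32)
    × IsMaximum RepetitionFree Example.final (+ 2 / 1)
    × (∀ σ → Example.Optimal σ →
    ∃[ S ] Nontrivial (ConnectedSet.set {G = Example.G} S) × 2 ≤ occurrences (ConnectedSet.set S) σ)
    × IsMinimum Example.Optimal length 4
theorem1p3 =
    ((optimal , _ , optimal-final) , λ σ _ → final-≤-65/32 σ)
  , ((BXC ∷ [] , BXC-repetitionFree , BXC-final) , final-≤-2-of-repetitionFree)
  , (λ σ σ-optimal → repetition σ (optimal⇒¬≤2 σ σ-optimal ∘ final-≤-2-of-repetitionFree σ))
  , (optimal , optimal-final , refl)
  , λ σ σ-optimal → ℕ.≮⇒≥ (optimal⇒¬≤2 σ σ-optimal ∘ final-≤-2-of-short σ)
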